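{- For every sufficiently large integer $m$ there is a pseudoexpander $H$ with $m$ roots in which every root has pseudodegree at most $m^{1/4.9}$.
   Context: Logarithms are base 2. A rooted tree is extended if none of its leaves has a sibling. A graph $H$ is a binary-tree-based graph if it is an edge-disjoint union of extended rooted trees $T_1,\dots,T_m$ with roots $t_1,\dots,t_m$ (the roots of $H$, forming ${\bf Roots}(H)$), such that every vertex that is a leaf of some $T_i$ is a leaf of exactly two of the trees, and any two trees share at most one vertex, which is a leaf in both. $T_i,T_j$ are adjacent if they share a leaf; then $\{t_i,t_j\}$ is a pseudoedge. The pseudodegree of $t_i$ is the number of pseudoedges containing $t_i$. A pseudomatching is a set of pseudoedges with pairwise disjoint ends; it is between disjoint $U,V\subseteq{\bf Roots}(H)$ if each of its pseudoedges has one end in $U$ and one in $V$. $H$ (with $m$ roots) is a pseudoexpander if (1) every $T_i$ has height (maximum number of vertices on a root–leaf path) at most $(\log m)/4.9+3$, and (2) for any disjoint $U,V\subseteq{\bf Roots}(H)$ with $|U|,|V|\ge m^{0.999}$ there is a pseudomatching between $U$ and $V$ of size at least $m^{0.999}/3$. -}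

module Defs where

open import Data.Nat using (ℕ; zero; suc; _+_; _*_; _∸_; _^_; _≤_)
open import Data.Fin using (Fin)
open import Data.Fin.Subset using (Subset; _∈_; ∣_∣; _∩_; Empty)
open import Data.Product using (Σ; ∃; _×_; _,_)
open import Data.Sum using (_⊎_)
open import Relation.Binary.PropositionalEquality using (_≡_; _≢_)
open import Relation.Nullary using (¬_)
open import Function.Definitions using (Injective)

-- A family of m rooted trees T_0..T_{m-1} inside the vertex set Fin n.
-- Tree T_i has vertex set (inT i), root (root i), parent map (parent i)
-- and depth function (depth i) (number of edges to the root).
-- The depth function witnesses acyclicity: every non-root vertex of T_i
-- has its parent in T_i at depth one less, so the parent pointers form a
-- rooted tree whose edges are {v , parent i v} for non-root v in T_i.
record TreeFamily (n m : ℕ) : Set where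
  field
    inT          : Fin m → Subset n
    root         : Fin m → Fin n
    parent       : Fin m → Fin n → Fin n
    depth        : Fin m → Fin n → ℕ
    root∈        : ∀ i → root i ∈ inT i
    root-depth   : ∀ i → depth i (root i) ≡ 0
    parent∈      : ∀ i v → v ∈ inT i → v ≢ root i → parent i v ∈ inT i
    parent-depth : ∀ i v → v ∈ inT i → v ≢ root i →
                   suc (depth i (parent i v)) ≡ depth i v

module _ {n m : ℕ} (F : TreeFamily n m) where
  open TreeFamily F

  NonRoot : Fin m → Fin n → Set
  NonRoot i v = v ∈ inT i × v ≢ root i

  IsLeaf : Fin m → Fin n → Set
  IsLeaf i v = v ∈ inT i × (∀ w → NonRoot i w → parent i w ≢ v)

  Extended : Fin m → Set
  Extended i = ∀ v w → IsLeaf i v → NonRoot i v → NonRoot i w →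
               parent i w ≡ parent i v → w ≡ v

  SameEdge : Fin m → Fin n → Fin m → Fin n → Set
  SameEdge i v j w = (v ≡ w × parent i v ≡ parent j w)
                   ⊎ (v ≡ parent j w × parent i v ≡ w)

  -- T_i and T_j (i ≠ j) are adjacent: they share a leaf.
  -- Since roots are distinct, pseudoedges {t_i,t_j} correspond to such pairs.
  Adjacent : Fin m → Fin m → Set
  Adjacent i j = i ≢ j × ∃ λ v → IsLeaf i v × IsLeaf j v

  -- H = union of the trees is a binary-tree-based graph
  record IsBinaryTreeBased : Set where
    field
      roots-distinct : Injective _≡_ _≡_ root
      covers         : ∀ v → ∃ λ i → v ∈ inT i          -- H is the union of the T_i
      extended       : ∀ i → Extended i
      edge-disjoint  : ∀ i j → i ≢ j → ∀ v w → NonRoot i v → NonRoot j w →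
                       ¬ SameEdge i v j w
      leaf-two       : ∀ i v → IsLeaf i v →
                       ∃ λ j → j ≢ i × IsLeaf j v ×
                         (∀ k → IsLeaf k v → k ≡ i ⊎ k ≡ j)
      share-leaf     : ∀ i j → i ≢ j → ∀ v → v ∈ inT i → v ∈ inT j →
                       IsLeaf i v × IsLeaf j v
      share-one      : ∀ i j → i ≢ j → ∀ v w → v ∈ inT i → v ∈ inT j →
                       w ∈ inT i → w ∈ inT j → v ≡ w

  record Pseudomatching (U V : Subset m) (s : ℕ) : Set where
    field
      a b   : Fin s → Fin m
      a∈U   : ∀ k → a k ∈ U
      b∈V   : ∀ k → b k ∈ V
      adj   : ∀ k → Adjacent (a k) (b k)
      a-inj : Injective _≡_ _≡_ a
      b-inj : Injective _≡_ _≡_ b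
      ab-disj : ∀ k l → a k ≢ b l

  -- Pseudoexpander, with real thresholds converted to exact ℕ inequalities:
  --  height ≤ (log₂ m)/4.9 + 3   ⇔   2^(49·(height ∸ 3)) ≤ m^10
  --     (height of T_i = max over its vertices v of depth v + 1)
  --  x ≥ m^0.999                 ⇔   m^999 ≤ x^1000
  --  s ≥ m^0.999 / 3             ⇔   m^999 ≤ (3·s)^1000
  record IsPseudoexpander : Set where
    field
      height : ∀ i v → v ∈ inT i → 2 ^ (49 * (suc (depth i v) ∸ 3)) ≤ m ^ 10
      expand : ∀ (U V : Subset m) → Empty (U ∩ V) →
               m ^ 999 ≤ ∣ U ∣ ^ 1000 → m ^ 999 ≤ ∣ V ∣ ^ 1000 →
               ∃ λ s → m ^ 999 ≤ (3 * s) ^ 1000 × Pseudomatching U V s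

  -- every root t_i has pseudodegree ≤ m^(1/4.9) = m^(10/49):
  -- any set N of roots forming pseudoedges with t_i has |N|^49 ≤ m^10
  PseudodegreeBound : Set
  PseudodegreeBound = ∀ i (N : Subset m) → (∀ j → j ∈ N → Adjacent i j) →
                      ∣ N ∣ ^ 49 ≤ m ^ 10

{-# OPTIONS --safe #-}

-- Let r be the integer part of m^(1/1000). It suffices to find a symmetric relation on the roots with O(r³) neighbours
-- per root and a set of at most m/(12r) exceptional roots such that any two disjoint sets of more than m/(3r)
-- non-exceptional roots contain a related pair: removing such pairs one after the other gives the pseudomatchings, and
-- subdivided stars with one leg per neighbour realise the relation as adjacency of trees of height 3.
--
-- The relation comes from a hitting set for the at most 4^m products A × B with |A|, |B| > m/(3r). Each product
-- contains at least a fraction 1/(9r²) of all pairs, so by averaging some pair lies in that fraction of the products not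
-- hit yet; choosing greedily, 9r²(2m + 1) pairs hit all of them. The exceptional roots are those lying on
-- at least 648r³ of these pairs; they are few, and the pairs containing them are discarded.

module Submission where

open import Defs
open import Data.Bool using (true; false; if_then_else_)
open import Data.Fin using (Fin; toℕ; fromℕ<; _≟_) renaming (_≤?_ to _≤ꟳ?_)
open import Data.Fin.Properties using (toℕ-fromℕ<; toℕ<n; toℕ-injective; ≤-antisym; ≤-total)
open import Data.Fin.Subset using (Subset; inside; outside; _∈_; _∉_; ∣_∣; _∩_; _─_; _-_; ⁅_⁆; Empty)
open import Data.Fin.Subset.Properties
  using (_∈?_; Empty-unique; ∣⊥∣≡0; x∈⁅x⁆; ∣⁅x⁆∣≡1; x∈p∩q⁺; x∈p∩q⁻; p─q⊆p)
open import Data.List using (List; []; _∷_; _++_; map; filter; concatMap; length; lookup; allFin; deduplicate; cartesianProduct)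
import Data.List.Membership.DecPropositional as DecMembership
open import Data.List.Membership.Propositional using (lose; find) renaming (_∈_ to _∈ˡ_; _∉_ to _∉ˡ_)
open import Data.List.Membership.Propositional.Properties
open import Data.List.Properties using (length-map; length-++; filter-++; length-filter; length-tabulate)
open import Data.List.Relation.Unary.All as All using (All; []; _∷_)
open import Data.List.Relation.Unary.All.Properties using (all-filter)
open import Data.List.Relation.Unary.AllPairs using ([]; _∷_)
open import Data.List.Relation.Unary.Any as Any using (Any; here; there; index; any?)
open import Data.List.Relation.Unary.Any.Properties using (lookup-index)
import Data.List.Relation.Unary.Unique.DecPropositional.Properties as DecUnique
open import Data.List.Relation.Unary.Unique.Propositional using (Unique)
import Data.List.Relation.Unary.Unique.Propositional.Properties as Unique
open import Data.Nat using (ℕ; zero; suc; pred; _+_; _*_; _∸_; _^_; _≤_; _<_; z≤n; s≤s; _≤?_; _<?_; NonZero; >-nonZero; >-nonZero⁻¹)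
open import Data.Nat.DivMod using (_/_; _%_; m/n*n≤m; m≡m%n+[m/n]*n; m%n<n)
open import Data.Nat.ListAction using (sum)
open import Data.Nat.Properties as ℕ using (module ≤-Reasoning)
open import Data.Nat.Tactic.RingSolver using (solve-∀)
open import Data.Product using (Σ; ∃; _×_; _,_; proj₁; proj₂)
open import Data.Product.Properties using () renaming (≡-dec to ×-≡-dec)
open import Data.Sum using (_⊎_; inj₁; inj₂; [_,_]′)
open import Data.Sum.Properties using () renaming (≡-dec to ⊎-≡-dec)
open import Data.Unit using (tt)
open import Data.Vec as Vec using ([]; _∷_)
open import Data.Vec.Properties using ([]=⇒lookup; lookup⇒[]=; lookup∘tabulate)
open import Function using (_∘_; id)
open import Function.Definitions using (Injective)
open import Relation.Binary using (DecidableEquality)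
open import Relation.Binary.PropositionalEquality
  using (_≡_; _≢_; refl; sym; trans; cong; cong₂; subst; module ≡-Reasoning)
open import Relation.Nullary using (¬_; Dec; yes; no; does; contradiction; ¬?; _×-dec_)
open import Relation.Nullary.Decidable using (dec-true)
open import Relation.Unary using (Decidable)

-- Lists and subsets of a finite set.

lookup-injective : ∀ {A : Set} {xs : List A} → Unique xs → ∀ {i j} → lookup xs i ≡ lookup xs j → i ≡ j
lookup-injective (_ ∷ _)  {Fin.zero}  {Fin.zero}  _  = refl
lookup-injective (x∉ ∷ _) {Fin.zero}  {Fin.suc j} eq = contradiction eq (All.lookup x∉ (∈-lookup j))
lookup-injective (x∉ ∷ _) {Fin.suc i} {Fin.zero}  eq = contradiction (sym eq) (All.lookup x∉ (∈-lookup i))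
lookup-injective (_ ∷ u)  {Fin.suc i} {Fin.suc j} eq = cong Fin.suc (lookup-injective u eq)

⟦_⟧ : ∀ {n} {P : Fin n → Set} → Decidable P → Subset n
⟦ P? ⟧ = Vec.tabulate (does ∘ P?)

module _ {n} {P : Fin n → Set} (P? : Decidable P) where

  ∈⟦⟧⁺ : ∀ {i} → P i → i ∈ ⟦ P? ⟧
  ∈⟦⟧⁺ {i} Pi = lookup⇒[]= i _ (trans (lookup∘tabulate _ i) (dec-true (P? i) Pi))

  ∈⟦⟧⁻ : ∀ {i} → i ∈ ⟦ P? ⟧ → P i
  ∈⟦⟧⁻ {i} i∈ with P? i in eq
  ... | yes Pi = Pi
  ... | no ¬Pi = contradiction
    (trans (sym ([]=⇒lookup i∈)) (trans (lookup∘tabulate _ i) (cong does eq))) λ ()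

∣p∣≤∣p─q∣+∣q∣ : ∀ {n} (p q : Subset n) → ∣ p ∣ ≤ ∣ p ─ q ∣ + ∣ q ∣
∣p∣≤∣p─q∣+∣q∣ []            []            = z≤n
∣p∣≤∣p─q∣+∣q∣ (outside ∷ p) (outside ∷ q) = ∣p∣≤∣p─q∣+∣q∣ p q
∣p∣≤∣p─q∣+∣q∣ (inside  ∷ p) (outside ∷ q) = s≤s (∣p∣≤∣p─q∣+∣q∣ p q)
∣p∣≤∣p─q∣+∣q∣ (outside ∷ p) (inside  ∷ q) =
  ℕ.≤-trans (∣p∣≤∣p─q∣+∣q∣ p q) (ℕ.+-monoʳ-≤ ∣ p ─ q ∣ (ℕ.n≤1+n _))
∣p∣≤∣p─q∣+∣q∣ (inside  ∷ p) (inside  ∷ q) =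
  ℕ.≤-trans (s≤s (∣p∣≤∣p─q∣+∣q∣ p q)) (ℕ.≤-reflexive (sym (ℕ.+-suc ∣ p ─ q ∣ ∣ q ∣)))

∣p∣≤1+∣p-x∣ : ∀ {n} (p : Subset n) x → ∣ p ∣ ≤ suc ∣ p - x ∣
∣p∣≤1+∣p-x∣ p x = ℕ.≤-trans (∣p∣≤∣p─q∣+∣q∣ p ⁅ x ⁆)
  (ℕ.≤-reflexive (trans (cong (∣ p - x ∣ +_) (∣⁅x⁆∣≡1 x)) (ℕ.+-comm _ 1)))

x∈p─q⇒x∉q : ∀ {n} (p q : Subset n) {x} → x ∈ p ─ q → x ∉ q
x∈p─q⇒x∉q (_ ∷ p) (inside  ∷ q) ()             Vec.here
x∈p─q⇒x∉q (_ ∷ p) (_       ∷ q) (Vec.there x∈) (Vec.there x∈q) = x∈p─q⇒x∉q p q x∈ x∈q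

x∉p-x : ∀ {n} (p : Subset n) x → x ∉ p - x
x∉p-x p x x∈ = x∈p─q⇒x∉q p ⁅ x ⁆ x∈ (x∈⁅x⁆ x)

-- Removing the head of the list from `p` costs at most one element. The list may contain
-- repetitions and elements outside `p`, so neighbour lists can be used as they are.
∣p∣≤length : ∀ {n} (p : Subset n) xs → (∀ {i} → i ∈ p → i ∈ˡ xs) → ∣ p ∣ ≤ length xs
∣p∣≤length {n} p []       p⊆ with p' ← Empty-unique {p = p} (λ (i , i∈p) → contradiction (p⊆ i∈p) λ ())
  = ℕ.≤-reflexive (trans (cong ∣_∣ p') (∣⊥∣≡0 n))
∣p∣≤length p (x ∷ xs) p⊆ = ℕ.≤-trans (∣p∣≤1+∣p-x∣ p x) (s≤s (∣p∣≤length (p - x) xs tail))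
  where
  tail : ∀ {i} → i ∈ p - x → i ∈ˡ xs
  tail i∈ with p⊆ (p─q⊆p p ⁅ x ⁆ i∈)
  ... | here refl = contradiction i∈ (x∉p-x p x)
  ... | there i∈xs = i∈xs

-- Realising a symmetric relation as adjacency of subdivided stars.

module SubdividedStars {m : ℕ} (nbrs : Fin m → List (Fin m))
  (irreflexive : ∀ {i} → i ∉ˡ nbrs i)
  (symmetric   : ∀ {i j} → j ∈ˡ nbrs i → i ∈ˡ nbrs j)
  (nonempty    : ∀ i → ∃ λ j → j ∈ˡ nbrs i)
  where

  -- Tree `i` has centre `hub i`. Its leg towards `j` runs through `mid i j` to a tip shared with
  -- tree `j`. The middle vertex belongs to tree `i` alone; it keeps leaves from being siblings and
  -- the trees edge-disjoint.
  Label : Set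
  Label = Fin m ⊎ (Fin m × Fin m) ⊎ (Fin m × Fin m)

  pattern hub i   = inj₁ i
  pattern mid i j = inj₂ (inj₁ (i , j))
  pattern tip i j = inj₂ (inj₂ (i , j))

  _≟ᴸ_ : DecidableEquality Label
  _≟ᴸ_ = ⊎-≡-dec _≟_ (⊎-≡-dec (×-≡-dec _≟_ _≟_) (×-≡-dec _≟_ _≟_))

  -- Sorting the two indices gives trees `i` and `j` the same label for their common leaf.
  tipOf : Fin m → Fin m → Label
  tipOf i j with i ≤ꟳ? j
  ... | yes _ = tip i j
  ... | no _  = tip j i

  tipOf-cases : ∀ i j → tipOf i j ≡ tip i j ⊎ tipOf i j ≡ tip j i
  tipOf-cases i j with i ≤ꟳ? j
  ... | yes _ = inj₁ refl
  ... | no _  = inj₂ refl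

  tipOf-comm : ∀ i j → tipOf i j ≡ tipOf j i
  tipOf-comm i j with i ≤ꟳ? j | j ≤ꟳ? i
  ... | yes i≤j | yes j≤i with refl ← ≤-antisym i≤j j≤i = refl
  ... | yes _   | no _    = refl
  ... | no _    | yes _   = refl
  ... | no i≰j  | no j≰i  = [ (λ p → contradiction p i≰j) , (λ p → contradiction p j≰i) ]′ (≤-total i j)

  tipOf-endpoints : ∀ {i j c d} → i ≢ j → tipOf i c ≡ tipOf j d → c ≡ j × d ≡ i
  tipOf-endpoints {i} {j} {c} {d} i≢j eq with tipOf-cases i c | tipOf-cases j d
  ... | inj₁ p | inj₁ q with refl ← trans (sym p) (trans eq q) = contradiction refl i≢j
  ... | inj₁ p | inj₂ q with refl ← trans (sym p) (trans eq q) = refl , refl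
  ... | inj₂ p | inj₁ q with refl ← trans (sym p) (trans eq q) = refl , refl
  ... | inj₂ p | inj₂ q with refl ← trans (sym p) (trans eq q) = contradiction refl i≢j

  -- Above a tip lies the middle vertex of the leg towards the other endpoint, whichever of the two
  -- positions `i` occupies.
  up : Fin m → Label → Label
  up i (hub _)   = hub i
  up i (mid _ _) = hub i
  up i (tip a b) = if does (a ≟ i) then mid i b else mid i a

  up-tipOf : ∀ i c → up i (tipOf i c) ≡ mid i c
  up-tipOf i c with tipOf-cases i c
  ... | inj₁ eq rewrite eq | dec-true (i ≟ i) refl = refl
  ... | inj₂ eq rewrite eq with c ≟ i
  ...   | yes refl = refl
  ...   | no _     = refl

  up≢tip : ∀ i x {a b} → up i x ≢ tip a b
  up≢tip i (tip a b) eq with does (a ≟ i) | eq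
  ... | true  | ()
  ... | false | ()

  up≢tipOf : ∀ i x {j c} → up i x ≢ tipOf j c
  up≢tipOf i x {j} {c} eq = [ up≢tip i x ∘ trans eq , up≢tip i x ∘ trans eq ]′ (tipOf-cases j c)

  level : Label → ℕ
  level (hub _)   = 0
  level (mid _ _) = 1
  level (tip _ _) = 2

  level-tipOf : ∀ i c → level (tipOf i c) ≡ 2
  level-tipOf i c = [ cong level , cong level ]′ (tipOf-cases i c)

  data Position (i : Fin m) (x : Label) : Set where
    at-hub :                         x ≡ hub i     → Position i x
    at-mid : ∀ {c} → c ∈ˡ nbrs i → x ≡ mid i c   → Position i x
    at-tip : ∀ {c} → c ∈ˡ nbrs i → x ≡ tipOf i c → Position i x

  labels : Fin m → List Label
  labels i = hub i ∷ map (mid i) (nbrs i) ++ map (tipOf i) (nbrs i)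

  ∈labels⁺ : ∀ {i x} → Position i x → x ∈ˡ labels i
  ∈labels⁺     (at-hub refl)    = here refl
  ∈labels⁺ {i} (at-mid c∈ refl) = there (∈-++⁺ˡ (∈-map⁺ (mid i) c∈))
  ∈labels⁺ {i} (at-tip c∈ refl) = there (∈-++⁺ʳ (map (mid i) (nbrs i)) (∈-map⁺ (tipOf i) c∈))

  ∈labels⁻ : ∀ {i x} → x ∈ˡ labels i → Position i x
  ∈labels⁻ (here eq) = at-hub eq
  ∈labels⁻ {i} (there x∈) with ∈-++⁻ (map (mid i) (nbrs i)) x∈
  ... | inj₁ x∈mids = let _ , c∈ , eq = ∈-map⁻ (mid i) x∈mids in at-mid c∈ eq
  ... | inj₂ x∈tips = let _ , c∈ , eq = ∈-map⁻ (tipOf i) x∈tips in at-tip c∈ eq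

  up-position : ∀ {i x} → Position i x → Position i (up i x)
  up-position     (at-hub refl)        = at-hub refl
  up-position     (at-mid _ refl)      = at-hub refl
  up-position {i} (at-tip {c} c∈ refl) = at-mid c∈ (up-tipOf i c)

  level-up : ∀ {i x} → Position i x → x ≢ hub i → suc (level (up i x)) ≡ level x
  level-up     (at-hub eq)         x≢hub = contradiction eq x≢hub
  level-up     (at-mid _ refl)     _     = refl
  level-up {i} (at-tip {c} _ refl) _     =
    trans (cong (suc ∘ level) (up-tipOf i c)) (sym (level-tipOf i c))

  open DecMembership _≟ᴸ_ using () renaming (_∈?_ to _∈ˡ?_)

  -- A shared tip is listed by both of its trees. Deduplication turns it into a single vertex and
  -- makes `name` injective.
  allLabels : List Label
  allLabels = deduplicate _≟ᴸ_ (concatMap labels (allFin m))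

  ∈allLabels⁺ : ∀ {i x} → Position i x → x ∈ˡ allLabels
  ∈allLabels⁺ {i} pos = ∈-deduplicate⁺ _≟ᴸ_ (∈-concatMap⁺ labels (lose (∈-allFin i) (∈labels⁺ pos)))

  ∈allLabels⁻ : ∀ {x} → x ∈ˡ allLabels → ∃ λ i → Position i x
  ∈allLabels⁻ x∈ with i , _ , x∈i ← find (∈-concatMap⁻ labels {xs = allFin m} (∈-deduplicate⁻ _≟ᴸ_ (concatMap labels (allFin m)) x∈))
    = i , ∈labels⁻ x∈i

  n : ℕ
  n = length allLabels

  name : Fin n → Label
  name = lookup allLabels

  name-injective : Injective _≡_ _≡_ name
  name-injective = lookup-injective (DecUnique.deduplicate-! _≟ᴸ_ (concatMap labels (allFin m)))

  vertex : ∀ {i x} → Position i x → ∃ λ v → name v ≡ x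
  vertex pos = index (∈allLabels⁺ pos) , sym (lookup-index (∈allLabels⁺ pos))

  hubV : ∀ i → ∃ λ v → name v ≡ hub i
  hubV i = vertex (at-hub {i} refl)

  position? : ∀ i v → Dec (name v ∈ˡ labels i)
  position? i v = name v ∈ˡ? labels i

  tree : Fin m → Subset n
  tree i = ⟦ position? i ⟧

  ∈tree⁺ : ∀ {i v} → Position i (name v) → v ∈ tree i
  ∈tree⁺ {i} = ∈⟦⟧⁺ (position? i) ∘ ∈labels⁺

  ∈tree⁻ : ∀ {i v} → v ∈ tree i → Position i (name v)
  ∈tree⁻ {i} = ∈labels⁻ ∘ ∈⟦⟧⁻ (position? i)

  parentV : Fin m → Fin n → Fin n
  parentV i v with position? i v
  ... | yes p = proj₁ (vertex (up-position (∈labels⁻ p)))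
  -- Default value outside tree `i`, where parents are never consulted.
  ... | no _  = v

  name-parentV : ∀ {i v} → v ∈ tree i → name (parentV i v) ≡ up i (name v)
  name-parentV {i} {v} v∈ with position? i v
  ... | yes p = proj₂ (vertex (up-position (∈labels⁻ p)))
  ... | no ¬p = contradiction (∈labels⁺ (∈tree⁻ v∈)) ¬p

  name≢hub : ∀ {i v} → v ≢ proj₁ (hubV i) → name v ≢ hub i
  name≢hub {i} v≢ eq = v≢ (name-injective (trans eq (sym (proj₂ (hubV i)))))

  family : TreeFamily n m
  family = record
    { inT          = tree
    ; root         = proj₁ ∘ hubV
    ; parent       = parentV
    ; depth        = λ _ → level ∘ name
    ; root∈        = λ i → ∈tree⁺ (at-hub (proj₂ (hubV i)))
    ; root-depth   = λ i → cong level (proj₂ (hubV i))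
    ; parent∈      = λ i v v∈ _ → ∈tree⁺ (subst (Position i) (sym (name-parentV v∈)) (up-position (∈tree⁻ v∈)))
    ; parent-depth = λ i v v∈ v≢ → trans (cong (suc ∘ level) (name-parentV v∈)) (level-up (∈tree⁻ v∈) (name≢hub v≢))
    }

  -- A tip has no children, because all values of `up` are hubs or middle vertices.
  leaf⁺ : ∀ {i c v} → c ∈ˡ nbrs i → name v ≡ tipOf i c → IsLeaf family i v
  leaf⁺ {i} c∈ eq = ∈tree⁺ (at-tip c∈ eq) , λ w (w∈ , _) par →
    up≢tipOf i (name w) (trans (sym (name-parentV w∈)) (trans (cong name par) eq))

  parent-not-leaf : ∀ {i x v} → Position i x → x ≢ hub i → name v ≡ up i x → ¬ IsLeaf family i v
  parent-not-leaf {i} {x} pos x≢hub eq (_ , childless) with w , nw ← vertex pos =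
    childless w (w∈ , λ { refl → x≢hub (trans (sym nw) (proj₂ (hubV i))) })
      (name-injective (trans (name-parentV w∈) (trans (cong (up i) nw) (sym eq))))
    where
    w∈ : w ∈ tree i
    w∈ = ∈tree⁺ (subst (Position i) (sym nw) pos)

  tipOf≢hub : ∀ {i c j} → tipOf i c ≢ hub j
  tipOf≢hub {i} {c} eq with tipOf-cases i c
  ... | inj₁ p with () ← trans (sym p) eq
  ... | inj₂ p with () ← trans (sym p) eq

  -- The hub has a child since `nbrs i` is nonempty, and a middle vertex has the tip of its leg as a
  -- child; only tips remain.
  leaf⁻ : ∀ {i v} → IsLeaf family i v → ∃ λ c → c ∈ˡ nbrs i × name v ≡ tipOf i c
  leaf⁻ {i} leaf with ∈tree⁻ (proj₁ leaf)
  ... | at-hub eq = contradiction leaf (parent-not-leaf (at-mid (proj₂ (nonempty i)) refl) (λ ()) eq)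
  ... | at-mid {c} c∈ eq = contradiction leaf
    (parent-not-leaf (at-tip c∈ refl) tipOf≢hub (trans eq (sym (up-tipOf i c))))
  ... | at-tip {c} c∈ eq = c , c∈ , eq

  -- Hubs and middle vertices carry the index of their tree, so distinct trees can only meet in a
  -- tip, and a tip determines its two endpoints. All intersection properties of the trees rest on
  -- this.
  common⇒tip : ∀ {i j x} → i ≢ j → Position i x → Position j x → j ∈ˡ nbrs i × x ≡ tipOf i j
  common⇒tip i≢j (at-hub refl)   (at-hub refl)   = contradiction refl i≢j
  common⇒tip i≢j (at-hub refl)   (at-mid _ ())
  common⇒tip i≢j (at-hub refl)   (at-tip _ eq)   = contradiction (sym eq) tipOf≢hub
  common⇒tip i≢j (at-mid _ refl) (at-hub ())
  common⇒tip i≢j (at-mid _ refl) (at-mid _ refl) = contradiction refl i≢j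
  common⇒tip i≢j (at-mid _ refl) (at-tip {d} _ eq) = contradiction (trans (cong level eq) (level-tipOf _ d)) λ ()
  common⇒tip i≢j (at-tip _ refl) (at-hub eq)     = contradiction eq tipOf≢hub
  common⇒tip i≢j (at-tip {c} _ refl) (at-mid _ eq) = contradiction (trans (sym (cong level eq)) (level-tipOf _ c)) λ ()
  common⇒tip i≢j (at-tip c∈ refl) (at-tip d∈ eq) with refl , refl ← tipOf-endpoints i≢j eq = c∈ , refl

  adjacent⁺ : ∀ {i j} → j ∈ˡ nbrs i → Adjacent family i j
  adjacent⁺ {i} {j} j∈ with v , nv ← vertex (at-tip j∈ refl) =
    (λ { refl → irreflexive j∈ }) , v , leaf⁺ j∈ nv , leaf⁺ (symmetric j∈) (trans nv (tipOf-comm i j))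

  adjacent⁻ : ∀ {i j} → Adjacent family i j → j ∈ˡ nbrs i
  adjacent⁻ (i≢j , v , (v∈i , _) , (v∈j , _)) = proj₁ (common⇒tip i≢j (∈tree⁻ v∈i) (∈tree⁻ v∈j))

  -- The tip of its leg is the only child of a middle vertex, which is why leaves have no siblings.
  up≡mid : ∀ {i x c} → Position i x → up i x ≡ mid i c → x ≡ tipOf i c
  up≡mid (at-hub refl) ()
  up≡mid (at-mid _ refl) ()
  up≡mid {i} (at-tip {d} _ refl) eq with refl ← trans (sym (up-tipOf i d)) eq = refl

  binaryTreeBased : IsBinaryTreeBased family
  binaryTreeBased = record
    { roots-distinct = λ {i} {j} eq → hub-injective (trans (sym (proj₂ (hubV i))) (trans (cong name eq) (proj₂ (hubV j))))
    ; covers         = λ v → let i , pos = ∈allLabels⁻ (∈-lookup v) in i , ∈tree⁺ pos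
    ; extended       = extended
    ; edge-disjoint  = edge-disjoint
    ; leaf-two       = leaf-two
    ; share-leaf     = share-leaf
    ; share-one      = λ i j i≢j v w v∈i v∈j w∈i w∈j → name-injective
        (trans (proj₂ (common⇒tip i≢j (∈tree⁻ v∈i) (∈tree⁻ v∈j)))
          (sym (proj₂ (common⇒tip i≢j (∈tree⁻ w∈i) (∈tree⁻ w∈j)))))
    }
    where
    hub-injective : ∀ {i j : Fin m} → hub i ≡ hub j → i ≡ j
    hub-injective refl = refl

    extended : ∀ i → Extended family i
    extended i v w leaf (v∈ , _) (w∈ , _) eq with c , _ , nv ← leaf⁻ leaf =
      name-injective (trans (up≡mid (∈tree⁻ w∈)
        (trans (sym (name-parentV w∈)) (trans (cong name eq) (trans (name-parentV v∈) (trans (cong (up i) nv) (up-tipOf i c))))))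
        (sym nv))

    share-leaf : ∀ i j → i ≢ j → ∀ v → v ∈ tree i → v ∈ tree j → IsLeaf family i v × IsLeaf family j v
    share-leaf i j i≢j v v∈i v∈j with j∈ , nv ← common⇒tip i≢j (∈tree⁻ v∈i) (∈tree⁻ v∈j) =
      leaf⁺ j∈ nv , leaf⁺ (symmetric j∈) (trans nv (tipOf-comm i j))

    edge-disjoint : ∀ i j → i ≢ j → ∀ v w → NonRoot family i v → NonRoot family j w → ¬ SameEdge family i v j w
    -- A shared child is the common tip; its parents `mid i j` and `mid j i` coincide only for equal
    -- indices.
    edge-disjoint i j i≢j v w (v∈ , _) (w∈ , _) (inj₁ (refl , eq))
      with j∈ , nv ← common⇒tip i≢j (∈tree⁻ v∈) (∈tree⁻ w∈)
      with refl ← trans (sym (trans (name-parentV v∈) (trans (cong (up i) nv) (up-tipOf i j))))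
                    (trans (cong name eq)
                      (trans (name-parentV w∈) (trans (cong (up j) (trans nv (tipOf-comm i j))) (up-tipOf j i))))
      = i≢j refl
    -- Depth is the level of the label in every tree, so an edge with opposite orientations in two
    -- trees would put each end strictly above the other.
    edge-disjoint i j i≢j v w (v∈ , v≢) (w∈ , w≢) (inj₂ (v≡ , refl)) =
      ℕ.m≢1+m+n _ {1} (trans (sym (parent-depth j w w∈ w≢))
        (trans (cong (suc ∘ level ∘ name) (sym v≡)) (trans (cong suc (sym (parent-depth i v v∈ v≢))) (cong suc (ℕ.+-comm 1 _)))))
      where open TreeFamily family using (parent-depth)

    leaf-two : ∀ i v → IsLeaf family i v → ∃ λ j → j ≢ i × IsLeaf family j v ×
               (∀ k → IsLeaf family k v → k ≡ i ⊎ k ≡ j)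
    leaf-two i v leaf with j , j∈ , nv ← leaf⁻ leaf =
      j , (λ { refl → irreflexive j∈ }) , leaf⁺ (symmetric j∈) (trans nv (tipOf-comm i j)) , others
      where
      others : ∀ k → IsLeaf family k v → k ≡ i ⊎ k ≡ j
      others k leafk with i ≟ k
      ... | yes refl = inj₁ refl
      ... | no i≢k with _ , _ , nv' ← leaf⁻ leafk = inj₂ (sym (proj₁ (tipOf-endpoints i≢k (trans (sym nv) nv'))))

  level≤2 : ∀ x → level x ≤ 2
  level≤2 (hub _)   = z≤n
  level≤2 (mid _ _) = s≤s z≤n
  level≤2 (tip _ _) = s≤s (s≤s z≤n)

-- Sums, counting and double counting over lists.

∑ : ∀ {A : Set} → List A → (A → ℕ) → ℕ
∑ xs f = sum (map f xs)

count : ∀ {A : Set} {P : A → Set} → Decidable P → List A → ℕ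
count P? xs = length (filter P? xs)

module _ {A : Set} where

  ∑-mono : ∀ (xs : List A) {f g : A → ℕ} → (∀ {x} → x ∈ˡ xs → f x ≤ g x) → ∑ xs f ≤ ∑ xs g
  ∑-mono []       f≤g = z≤n
  ∑-mono (x ∷ xs) f≤g = ℕ.+-mono-≤ (f≤g (here refl)) (∑-mono xs (f≤g ∘ there))

  ∑-const : ∀ (xs : List A) c → ∑ xs (λ _ → c) ≡ length xs * c
  ∑-const []       c = refl
  ∑-const (x ∷ xs) c = cong (c +_) (∑-const xs c)

  ∑-+ : ∀ (xs : List A) (f g : A → ℕ) → ∑ xs (λ x → f x + g x) ≡ ∑ xs f + ∑ xs g
  ∑-+ []       f g = refl
  ∑-+ (x ∷ xs) f g = trans (cong (f x + g x +_) (∑-+ xs f g)) (interchange (f x) (g x) (∑ xs f) (∑ xs g))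
    where
    interchange : ∀ a b c d → a + b + (c + d) ≡ a + c + (b + d)
    interchange = solve-∀

  ∑-* : ∀ (xs : List A) c (f : A → ℕ) → ∑ xs (λ x → c * f x) ≡ c * ∑ xs f
  ∑-* []       c f = sym (ℕ.*-zeroʳ c)
  ∑-* (x ∷ xs) c f = trans (cong (c * f x +_) (∑-* xs c f)) (sym (ℕ.*-distribˡ-+ c (f x) (∑ xs f)))

  module _ {P : A → Set} (P? : Decidable P) where

    indicator : A → ℕ
    indicator x = if does (P? x) then 1 else 0

    count-∷ : ∀ x xs → count P? (x ∷ xs) ≡ indicator x + count P? xs
    count-∷ x xs with does (P? x)
    ... | true  = refl
    ... | false = refl

    count-++ : ∀ xs ys → count P? (xs ++ ys) ≡ count P? xs + count P? ys
    count-++ xs ys = trans (cong length (filter-++ P? xs ys)) (length-++ (filter P? xs))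

    count-complement : ∀ xs → count (¬? ∘ P?) xs + count P? xs ≡ length xs
    count-complement []       = refl
    count-complement (x ∷ xs) with does (P? x)
    ... | true  = trans (ℕ.+-suc _ _) (cong suc (count-complement xs))
    ... | false = cong suc (count-complement xs)

  markov : ∀ {P : A → Set} (P? : Decidable P) {f : A → ℕ} {D} → (∀ {x} → P x → D ≤ f x) →
           ∀ xs → count P? xs * D ≤ ∑ xs f
  markov P? D≤f []       = z≤n
  markov P? {f} D≤f (x ∷ xs) with P? x
  ... | yes px = ℕ.+-mono-≤ (D≤f px) (markov P? D≤f xs)
  ... | no _   = ℕ.m≤n⇒m≤o+n (f x) (markov P? D≤f xs)

  count-≡≤1 : ∀ {P : A → Set} (P? : Decidable P) → (∀ {x y} → P x → P y → x ≡ y) →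
              ∀ {xs} → Unique xs → count P? xs ≤ 1
  count-≡≤1 P? P-prop {xs} unique = go (filter P? xs) (all-filter P? xs) (Unique.filter⁺ P? unique)
    where
    go : ∀ ys → All _ ys → Unique ys → length ys ≤ 1
    go []          _             _                 = z≤n
    go (_ ∷ [])    _             _                 = s≤s z≤n
    go (_ ∷ _ ∷ _) (px ∷ py ∷ _) ((x≢y ∷ _) ∷ _) = contradiction (P-prop px py) x≢y

module _ {A B : Set} {R : A → B → Set} (R? : ∀ x y → Dec (R x y)) where

  -- Double counting of the related pairs, by rows and by columns.
  ∑-count-swap : ∀ xs ys → ∑ xs (λ x → count (R? x) ys) ≡ ∑ ys (λ y → count (λ x → R? x y) xs)
  ∑-count-swap []       ys = sym (trans (∑-const ys 0) (ℕ.*-zeroʳ (length ys)))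
  ∑-count-swap (x ∷ xs) ys = let open ≡-Reasoning in begin
    count (R? x) ys + ∑ xs (λ x → count (R? x) ys)                         ≡⟨ cong₂ _+_ (count-∑ ys) (∑-count-swap xs ys) ⟩
    ∑ ys (indicator (R? x)) + ∑ ys (λ y → count (λ x → R? x y) xs)         ≡⟨ ∑-+ ys _ _ ⟨
    ∑ ys (λ y → indicator (R? x) y + count (λ x → R? x y) xs)              ≡⟨ ∑-cong ys ⟨
    ∑ ys (λ y → count (λ x → R? x y) (x ∷ xs))                             ∎
    where
    count-∑ : ∀ ys → count (R? x) ys ≡ ∑ ys (indicator (R? x))
    count-∑ []       = refl
    count-∑ (y ∷ ys) = trans (count-∷ (R? x) y ys) (cong (indicator (R? x) y +_) (count-∑ ys))
    ∑-cong : ∀ ys → ∑ ys (λ y → count (λ x → R? x y) (x ∷ xs)) ≡ ∑ ys (λ y → indicator (R? x) y + count (λ x → R? x y) xs)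
    ∑-cong []       = refl
    ∑-cong (y ∷ ys) = cong₂ _+_ (count-∷ (λ x → R? x y) x xs) (∑-cong ys)

length-cartesianProduct : ∀ {A B : Set} (xs : List A) (ys : List B) →
                          length (cartesianProduct xs ys) ≡ length xs * length ys
length-cartesianProduct []       ys = refl
length-cartesianProduct (x ∷ xs) ys = trans (length-++ (map (x ,_) ys))
  (cong₂ _+_ (length-map (x ,_) ys) (length-cartesianProduct xs ys))

module _ {A B : Set} {P : A → Set} {Q : B → Set} (P? : Decidable P) (Q? : Decidable Q) where

  private
    PQ? : Decidable (λ (e : A × B) → P (proj₁ e) × Q (proj₂ e))
    PQ? (x , y) = P? x ×-dec Q? y

  count-row⁺ : ∀ {x} → P x → ∀ ys → count PQ? (map (x ,_) ys) ≡ count Q? ys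
  count-row⁺ px []       = refl
  count-row⁺ {x} px (y ∷ ys) with P? x | Q? y
  ... | yes _  | yes _ = cong suc (count-row⁺ px ys)
  ... | yes _  | no _  = count-row⁺ px ys
  ... | no ¬px | _     = contradiction px ¬px

  count-cartesianProduct : ∀ xs ys → count P? xs * count Q? ys ≤ count PQ? (cartesianProduct xs ys)
  count-cartesianProduct []       ys = z≤n
  count-cartesianProduct (x ∷ xs) ys =
    ℕ.≤-trans split (ℕ.≤-reflexive (sym (count-++ PQ? (map (x ,_) ys) (cartesianProduct xs ys))))
    where
    split : count P? (x ∷ xs) * count Q? ys ≤ count PQ? (map (x ,_) ys) + count PQ? (cartesianProduct xs ys)
    split with P? x
    ... | yes px = ℕ.+-mono-≤ (ℕ.≤-reflexive (sym (count-row⁺ px ys))) (count-cartesianProduct xs ys)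
    ... | no _   = ℕ.m≤n⇒m≤o+n _ (count-cartesianProduct xs ys)

-- Greedy hitting sets.

module HittingSet {E Y : Set} {Hits : E → Y → Set} (hits? : ∀ x y → Dec (Hits x y))
  (universe : List E) (nonempty : 0 < length universe) (r : ℕ) where

  -- Density at least 1/(r+1), with the denominator cleared. In this form a greedy step shrinks the
  -- family by the factor r/(r+1).
  Frequent : List Y → Set
  Frequent F = ∀ {y} → y ∈ˡ F → length universe ≤ suc r * count (λ x → hits? x y) universe

  -- Averaging. If every `x` fell strictly short, each would contribute a deficit of at least 1.
  -- Summing over the universe and exchanging the order of summation then gives
  -- `length universe ≤ 0`.
  popular : ∀ F → Frequent F → ∃ λ x → length F ≤ suc r * count (hits? x) F
  popular F freq with any? (λ x → length F ≤? suc r * count (hits? x) F) universe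
  ... | yes found = Any.satisfied found
  ... | no ¬found = contradiction nonempty (ℕ.≤⇒≯ (ℕ.+-cancelʳ-≤ (length F * length universe) _ _ (begin
    length universe + length F * length universe
      ≡⟨ cong₂ _+_ (trans (∑-const universe 1) (ℕ.*-identityʳ _)) (∑-const F (length universe)) ⟨
    ∑ universe (λ _ → 1) + ∑ F (λ _ → length universe)
      ≤⟨ ℕ.+-monoʳ-≤ (∑ universe (λ _ → 1)) (∑-mono F freq) ⟩
    ∑ universe (λ _ → 1) + ∑ F (λ y → suc r * count (λ x → hits? x y) universe)
      ≡⟨ cong (∑ universe (λ _ → 1) +_) (trans (∑-* F (suc r) _) (trans (cong (suc r *_) (sym (∑-count-swap hits? universe F))) (sym (∑-* universe (suc r) _)))) ⟩
    ∑ universe (λ _ → 1) + ∑ universe (λ x → suc r * count (hits? x) F)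
      ≡⟨ ∑-+ universe _ _ ⟨
    ∑ universe (λ x → suc (suc r * count (hits? x) F))
      ≤⟨ ∑-mono universe (λ x∈ → ℕ.≰⇒> λ le → ¬found (lose x∈ le)) ⟩
    ∑ universe (λ _ → length F)
      ≡⟨ trans (∑-const universe (length F)) (ℕ.*-comm (length universe) (length F)) ⟩
    0 + length F * length universe ∎)))
    where open ≤-Reasoning

  -- Each round picks a popular element and passes on only the members it misses, at most a fraction
  -- r/(r+1) of them. Density is a condition on single members, so the rest stays frequent.
  greedy : ∀ t F → Frequent F → ∃ λ L → length L ≡ t × ∃ λ F′ →
           (∀ {y} → y ∈ˡ F → Any (λ x → Hits x y) L ⊎ y ∈ˡ F′) ×
           suc r ^ t * length F′ ≤ r ^ t * length F
  greedy zero    F freq = [] , refl , F , inj₂ , ℕ.≤-refl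
  greedy (suc t) F freq
    with x , pop ← popular F freq
    with L , len , F′ , covered , bound ← greedy t (filter (¬? ∘ hits? x) F) (freq ∘ proj₁ ∘ ∈-filter⁻ (¬? ∘ hits? x))
    = x ∷ L , cong suc len , F′ , covered′ , bound′
    where
    missed = count (¬? ∘ hits? x) F
    covered′ : ∀ {y} → y ∈ˡ F → Any (λ x → Hits x y) (x ∷ L) ⊎ y ∈ˡ F′
    covered′ {y} y∈ with hits? x y
    ... | yes h = inj₁ (here h)
    ... | no ¬h = [ inj₁ ∘ there , inj₂ ]′ (covered (∈-filter⁺ (¬? ∘ hits? x) y∈ ¬h))
    open ≤-Reasoning
    shrink : suc r * missed ≤ r * length F
    shrink = ℕ.+-cancelʳ-≤ (length F) _ _ (begin
      suc r * missed + length F                        ≤⟨ ℕ.+-monoʳ-≤ (suc r * missed) pop ⟩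
      suc r * missed + suc r * count (hits? x) F       ≡⟨ ℕ.*-distribˡ-+ (suc r) missed _ ⟨
      suc r * (missed + count (hits? x) F)             ≡⟨ cong (suc r *_) (count-complement (hits? x) F) ⟩
      suc r * length F                                 ≡⟨ ℕ.+-comm (length F) _ ⟩
      r * length F + length F                          ∎)
    bound′ : suc r ^ suc t * length F′ ≤ r ^ suc t * length F
    bound′ = begin
      suc r * suc r ^ t * length F′    ≡⟨ ℕ.*-assoc (suc r) (suc r ^ t) (length F′) ⟩
      suc r * (suc r ^ t * length F′)  ≤⟨ ℕ.*-monoʳ-≤ (suc r) bound ⟩
      suc r * (r ^ t * missed)         ≡⟨ swap (suc r) (r ^ t) missed ⟩
      r ^ t * (suc r * missed)         ≤⟨ ℕ.*-monoʳ-≤ (r ^ t) shrink ⟩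
      r ^ t * (r * length F)           ≡⟨ trans (sym (ℕ.*-assoc (r ^ t) r _)) (cong (_* length F) (ℕ.*-comm (r ^ t) r)) ⟩
      r * r ^ t * length F             ∎
      where
      swap : ∀ a b c → a * (b * c) ≡ b * (a * c)
      swap = solve-∀

-- Bernoulli's inequality (1 + 1/r)^n ≥ 1 + n/r with denominators cleared.
bernoulli : ∀ r n → r ^ n * (r + n) ≤ suc r ^ n * r
bernoulli r zero    = ℕ.≤-reflexive (trans (ℕ.+-identityʳ _) (trans (ℕ.+-identityʳ r) (sym (ℕ.+-identityʳ r))))
bernoulli r (suc n) = begin
  r * r ^ n * (r + suc n)            ≤⟨ ℕ.m≤m+n _ (r ^ n * n) ⟩
  r * r ^ n * (r + suc n) + r ^ n * n ≡⟨ expand r (r ^ n) n ⟩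
  suc r * (r ^ n * (r + n))          ≤⟨ ℕ.*-monoʳ-≤ (suc r) (bernoulli r n) ⟩
  suc r * (suc r ^ n * r)            ≡⟨ ℕ.*-assoc (suc r) (suc r ^ n) r ⟨
  suc r * suc r ^ n * r              ∎
  where
  open ≤-Reasoning
  expand : ∀ r p n → r * p * (r + suc n) + p * n ≡ suc r * (p * (r + n))
  expand = solve-∀

-- Bernoulli with n = r + 1 gives (1 + 1/r)^(r+1) ≥ 2: this many greedy rounds at least halve the
-- family.
2*r^[1+r]≤[1+r]^[1+r] : ∀ r → 2 * r ^ suc r ≤ suc r ^ suc r
2*r^[1+r]≤[1+r]^[1+r] zero      = z≤n
2*r^[1+r]≤[1+r]^[1+r] r@(suc _) = ℕ.*-cancelʳ-≤ _ _ r (begin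
  2 * r ^ suc r * r          ≡⟨ swap (r ^ suc r) r ⟩
  r ^ suc r * (r + r)        ≤⟨ ℕ.*-monoʳ-≤ (r ^ suc r) (ℕ.+-monoʳ-≤ r (ℕ.n≤1+n r)) ⟩
  r ^ suc r * (r + suc r)    ≤⟨ bernoulli r (suc r) ⟩
  suc r ^ suc r * r          ∎)
  where
  open ≤-Reasoning
  swap : ∀ p r → 2 * p * r ≡ p * (r + r)
  swap = solve-∀

2^j*a^j≤b^j : ∀ {a b} j → 2 * a ≤ b → 2 ^ j * a ^ j ≤ b ^ j
2^j*a^j≤b^j         zero    2a≤b = s≤s z≤n
2^j*a^j≤b^j {a} {b} (suc j) 2a≤b = begin
  2 * 2 ^ j * (a * a ^ j)    ≡⟨ interchange (2 ^ j) a (a ^ j) ⟩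
  2 * a * (2 ^ j * a ^ j)    ≤⟨ ℕ.*-mono-≤ 2a≤b (2^j*a^j≤b^j j 2a≤b) ⟩
  b * b ^ j                  ∎
  where
  open ≤-Reasoning
  interchange : ∀ p a q → 2 * p * (a * q) ≡ 2 * a * (p * q)
  interchange = solve-∀

module _ {E Y : Set} {Hits : E → Y → Set} (hits? : ∀ x y → Dec (Hits x y))
  (universe : List E) (nonempty : 0 < length universe) (r : ℕ) where
  open HittingSet hits? universe nonempty r

  -- After `j` halvings, each taking `suc r` rounds, a family of fewer than `2 ^ j` members has less
  -- than one survivor.
  hittingSet : ∀ j F → Frequent F → length F < 2 ^ j →
               ∃ λ L → length L ≡ suc r * j × (∀ {y} → y ∈ˡ F → Any (λ x → Hits x y) L)
  hittingSet j F freq small with greedy (suc r * j) F freq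
  ... | L , len , [] , covered , bound = L , len , λ y∈ → [ id , (λ ()) ]′ (covered y∈)
  ... | L , len , F′@(_ ∷ _) , covered , bound = contradiction small (ℕ.≤⇒≯ (ℕ.*-cancelˡ-≤ (r ^ t) {{r^t≢0}} (begin
      r ^ t * 2 ^ j            ≡⟨ ℕ.*-comm (r ^ t) (2 ^ j) ⟩
      2 ^ j * r ^ t            ≡⟨ cong (2 ^ j *_) (ℕ.^-*-assoc r (suc r) j) ⟨
      2 ^ j * (r ^ suc r) ^ j  ≤⟨ 2^j*a^j≤b^j j (2*r^[1+r]≤[1+r]^[1+r] r) ⟩
      (suc r ^ suc r) ^ j      ≡⟨ ℕ.^-*-assoc (suc r) (suc r) j ⟩
      suc r ^ t                ≤⟨ ℕ.m≤m*n _ (length F′) ⟩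
      suc r ^ t * length F′    ≤⟨ bound ⟩
      r ^ t * length F         ∎)))
    where
    t = suc r * j
    open ≤-Reasoning
    -- A survivor makes the left side of `bound` positive, hence also the right side.
    r^t≢0 : NonZero (r ^ t)
    r^t≢0 = ℕ.m*n≢0⇒m≢0 (r ^ t) {{>-nonZero (ℕ.≤-trans (ℕ.*-mono-≤ (ℕ.m^n>0 (suc r) t) (s≤s z≤n)) bound)}}

-- Few edges joining all pairs of large sets.

subsets : ∀ n → List (Subset n)
subsets zero    = [] ∷ []
subsets (suc n) = map (inside ∷_) (subsets n) ++ map (outside ∷_) (subsets n)

∈-subsets : ∀ {n} (p : Subset n) → p ∈ˡ subsets n
∈-subsets []            = here refl
∈-subsets (inside ∷ p)  = ∈-++⁺ˡ (∈-map⁺ (inside ∷_) (∈-subsets p))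
∈-subsets (outside ∷ p) = ∈-++⁺ʳ (map (inside ∷_) (subsets _)) (∈-map⁺ (outside ∷_) (∈-subsets p))

length-subsets : ∀ n → length (subsets n) ≡ 2 ^ n
length-subsets zero    = refl
length-subsets (suc n) = trans (length-++ (map (inside ∷_) (subsets n)))
  (cong₂ _+_ (trans (length-map _ (subsets n)) (length-subsets n))
    (trans (length-map _ (subsets n)) (trans (length-subsets n) (sym (ℕ.+-identityʳ _)))))

module _ {m : ℕ} where

  Joins : Fin m × Fin m → Subset m × Subset m → Set
  Joins (x , y) (A , B) = x ∈ A × y ∈ B

  joins? : ∀ e p → Dec (Joins e p)
  joins? (x , y) (A , B) = (x ∈? A) ×-dec (y ∈? B)

  -- A product of two sets of size at least `k` contains at least k² of the m² ordered pairs, which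
  -- is the required density 1/(r+1). There are at most 4^m such products; the strict bound in
  -- `hittingSet` accounts for the exponent 2m + 1.
  joiningEdges : 0 < m → ∀ r k → m * m ≤ suc r * (k * k) →
    ∃ λ L → length L ≡ suc r * suc (m + m) ×
    (∀ A B → k ≤ ∣ A ∣ → k ≤ ∣ B ∣ → Any (λ e → Joins e (A , B)) L)
  joiningEdges 0<m r k large =
    let L , len , hit = hittingSet joins? edges (subst (0 <_) (sym length-edges) (ℕ.*-mono-≤ 0<m 0<m)) r (suc (m + m)) family
                          frequent family-small
    in L , len , λ A B k≤A k≤B → hit (∈-filter⁺ big? (∈-cartesianProduct⁺ (∈-subsets A) (∈-subsets B)) (k≤A , k≤B))
    where
    open ≤-Reasoning
    edges : List (Fin m × Fin m)
    edges = cartesianProduct (allFin m) (allFin m)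
    length-edges : length edges ≡ m * m
    length-edges = trans (length-cartesianProduct (allFin m) (allFin m))
      (cong₂ _*_ (length-tabulate {n = m} id) (length-tabulate {n = m} id))
    big? : Decidable (λ (p : Subset m × Subset m) → k ≤ ∣ proj₁ p ∣ × k ≤ ∣ proj₂ p ∣)
    big? (A , B) = (k ≤? ∣ A ∣) ×-dec (k ≤? ∣ B ∣)
    family : List (Subset m × Subset m)
    family = filter big? (cartesianProduct (subsets m) (subsets m))
    size≤count : ∀ (A : Subset m) → ∣ A ∣ ≤ count (_∈? A) (allFin m)
    size≤count A = ∣p∣≤length A _ (∈-filter⁺ (_∈? A) (∈-allFin _))
    frequent : ∀ {p} → p ∈ˡ family → length edges ≤ suc r * count (λ e → joins? e p) edges
    frequent {A , B} p∈ with _ , k≤A , k≤B ← ∈-filter⁻ big? {xs = cartesianProduct (subsets m) (subsets m)} p∈ = begin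
      length edges        ≡⟨ length-edges ⟩
      m * m               ≤⟨ large ⟩
      suc r * (k * k)     ≤⟨ ℕ.*-monoʳ-≤ (suc r) (ℕ.≤-trans
                               (ℕ.*-mono-≤ (ℕ.≤-trans k≤A (size≤count A)) (ℕ.≤-trans k≤B (size≤count B)))
                               (count-cartesianProduct (_∈? A) (_∈? B) (allFin m) (allFin m))) ⟩
      suc r * count (λ e → joins? e (A , B)) edges ∎
    family-small : length family < 2 ^ suc (m + m)
    family-small = begin-strict
      length family                                       ≤⟨ length-filter big? (cartesianProduct (subsets m) (subsets m)) ⟩
      length (cartesianProduct (subsets m) (subsets m))   ≡⟨ length-cartesianProduct (subsets m) (subsets m) ⟩
      length (subsets m) * length (subsets m)             ≡⟨ cong₂ _*_ (length-subsets m) (length-subsets m) ⟩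
      2 ^ m * 2 ^ m                                       ≡⟨ ℕ.^-distribˡ-+-* 2 m m ⟨
      2 ^ (m + m)                                         <⟨ ℕ.^-monoʳ-< 2 (s≤s (s≤s z≤n)) (ℕ.n<1+n (m + m)) ⟩
      2 ^ suc (m + m)                                     ∎

-- Capping the degrees of the graph of joining edges.

module CappedGraph {m : ℕ} (L : List (Fin m × Fin m)) (D : ℕ) where

  -- Multiplicities are kept, and a loop appears on both sides, so that `degree` counts edge ends.
  out into incident : Fin m → List (Fin m)
  out i      = map proj₂ (filter (λ e → proj₁ e ≟ i) L)
  into i     = map proj₁ (filter (λ e → proj₂ e ≟ i) L)
  incident i = out i ++ into i

  degree : Fin m → ℕ
  degree i = length (incident i)

  ∈out : ∀ {x y} → (x , y) ∈ˡ L → y ∈ˡ out x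
  ∈out {x} e∈ = ∈-map⁺ proj₂ (∈-filter⁺ (λ e → proj₁ e ≟ x) e∈ refl)

  ∈into : ∀ {x y} → (x , y) ∈ˡ L → x ∈ˡ into y
  ∈into {y = y} e∈ = ∈-map⁺ proj₁ (∈-filter⁺ (λ e → proj₂ e ≟ y) e∈ refl)

  incident-sym : ∀ {i j} → j ∈ˡ incident i → i ∈ˡ incident j
  incident-sym {i} {j} j∈ with ∈-++⁻ (out i) j∈
  ... | inj₁ j∈out with _ , e∈ , refl ← ∈-map⁻ proj₂ j∈out
                   with e∈L , refl ← ∈-filter⁻ (λ e → proj₁ e ≟ i) {xs = L} e∈ = ∈-++⁺ʳ (out j) (∈into e∈L)
  ... | inj₂ j∈into with _ , e∈ , refl ← ∈-map⁻ proj₁ j∈into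
                    with e∈L , refl ← ∈-filter⁻ (λ e → proj₂ e ≟ i) {xs = L} e∈ = ∈-++⁺ˡ (∈out e∈L)

  -- Handshake argument: each edge is counted once for each of its two ends.
  ∑degree : ∑ (allFin m) degree ≤ length L + length L
  ∑degree = begin
    ∑ (allFin m) degree
      ≤⟨ ∑-mono (allFin m) (λ {i} _ → ℕ.≤-reflexive (trans (length-++ (out i)) (cong₂ _+_ (length-map proj₂ (filter (λ e → proj₁ e ≟ i) L)) (length-map proj₁ (filter (λ e → proj₂ e ≟ i) L))))) ⟩
    ∑ (allFin m) (λ i → count (λ e → proj₁ e ≟ i) L + count (λ e → proj₂ e ≟ i) L)
      ≡⟨ ∑-+ (allFin m) _ _ ⟩
    ∑ (allFin m) (λ i → count (λ e → proj₁ e ≟ i) L) + ∑ (allFin m) (λ i → count (λ e → proj₂ e ≟ i) L)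
      ≤⟨ ℕ.+-mono-≤ (endpoints proj₁) (endpoints proj₂) ⟩
    length L + length L ∎
    where
    open ≤-Reasoning
    endpoints : ∀ (end : Fin m × Fin m → Fin m) → ∑ (allFin m) (λ i → count (λ e → end e ≟ i) L) ≤ length L
    endpoints end = begin
      ∑ (allFin m) (λ i → count (λ e → end e ≟ i) L)  ≡⟨ ∑-count-swap (λ i e → end e ≟ i) (allFin m) L ⟩
      ∑ L (λ e → count (end e ≟_) (allFin m))         ≤⟨ ∑-mono L (λ {e} _ → count-≡≤1 (end e ≟_) (λ p q → trans (sym p) q) (Unique.allFin⁺ m)) ⟩
      ∑ L (λ _ → 1)                                   ≡⟨ trans (∑-const L 1) (ℕ.*-identityʳ _) ⟩
      length L                                        ∎

  heavy? : Decidable (λ i → D ≤ degree i)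
  heavy? i = D ≤? degree i

  heavy : Subset m
  heavy = ⟦ heavy? ⟧

  -- Markov's inequality applied to the degrees.
  ∣heavy∣*D≤ : ∣ heavy ∣ * D ≤ length L + length L
  ∣heavy∣*D≤ = ℕ.≤-trans
    (ℕ.*-monoˡ-≤ D (∣p∣≤length heavy (filter heavy? (allFin m)) (λ i∈ → ∈-filter⁺ heavy? (∈-allFin _) (∈⟦⟧⁻ heavy? i∈))))
    (ℕ.≤-trans (markov heavy? id (allFin m)) ∑degree)

  kept? : ∀ i → Decidable (λ j → i ≢ j × ¬ (D ≤ degree j))
  kept? i j = ¬? (i ≟ j) ×-dec ¬? (heavy? j)

  -- Edges at a heavy root are dropped from the lists of both ends, so the relation remains
  -- symmetric.
  kept : Fin m → List (Fin m)
  kept i with heavy? i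
  ... | yes _ = []
  ... | no _  = filter (kept? i) (incident i)

  ∈kept⁺ : ∀ {i j} → ¬ (D ≤ degree i) → ¬ (D ≤ degree j) → i ≢ j → j ∈ˡ incident i → j ∈ˡ kept i
  ∈kept⁺ {i} ¬hi ¬hj i≢j j∈ with heavy? i
  ... | yes hi = contradiction hi ¬hi
  ... | no _   = ∈-filter⁺ (kept? i) j∈ (i≢j , ¬hj)

  ∈kept⁻ : ∀ {i j} → j ∈ˡ kept i → ¬ (D ≤ degree i) × ¬ (D ≤ degree j) × i ≢ j × j ∈ˡ incident i
  ∈kept⁻ {i} j∈ with heavy? i
  ... | no ¬hi with j∈i , i≢j , ¬hj ← ∈-filter⁻ (kept? i) {xs = incident i} j∈ = ¬hi , ¬hj , i≢j , j∈i

  kept-sym : ∀ {i j} → j ∈ˡ kept i → i ∈ˡ kept j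
  kept-sym j∈ with ¬hi , ¬hj , i≢j , j∈i ← ∈kept⁻ j∈ = ∈kept⁺ ¬hj ¬hi (i≢j ∘ sym) (incident-sym j∈i)

  length-kept : ∀ i → length (kept i) ≤ D
  length-kept i with heavy? i
  ... | yes _  = z≤n
  ... | no ¬hi = ℕ.≤-trans (length-filter (kept? i) (incident i)) (ℕ.<⇒≤ (ℕ.≰⇒> ¬hi))

  -- The path through all roots in numerical order gives every root a neighbour and adds at most 2
  -- to each degree.
  next prev : Fin m → List (Fin m)
  next i with suc (toℕ i) <? m
  ... | yes i+1<m = fromℕ< i+1<m ∷ []
  ... | no _      = []
  prev i with toℕ i | toℕ<n i
  ... | zero  | _     = []
  ... | suc k | k+1<m = fromℕ< (ℕ.<⇒≤ k+1<m) ∷ []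

  ∈next⁺ : ∀ {i j} → suc (toℕ i) ≡ toℕ j → j ∈ˡ next i
  ∈next⁺ {i} {j} eq with suc (toℕ i) <? m
  ... | yes i+1<m = here (toℕ-injective (trans (sym eq) (sym (toℕ-fromℕ< i+1<m))))
  ... | no i+1≮m  = contradiction (subst (_< m) (sym eq) (toℕ<n j)) i+1≮m

  ∈next⁻ : ∀ {i j} → j ∈ˡ next i → suc (toℕ i) ≡ toℕ j
  ∈next⁻ {i} j∈ with suc (toℕ i) <? m
  ∈next⁻ (here refl) | yes i+1<m = sym (toℕ-fromℕ< i+1<m)

  ∈prev⁺ : ∀ {i j} → suc (toℕ j) ≡ toℕ i → j ∈ˡ prev i
  ∈prev⁺ {i} {j} eq with toℕ i | toℕ<n i
  ∈prev⁺ refl | suc k | k+1<m = here (toℕ-injective (sym (toℕ-fromℕ< (ℕ.<⇒≤ k+1<m))))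

  ∈prev⁻ : ∀ {i j} → j ∈ˡ prev i → suc (toℕ j) ≡ toℕ i
  ∈prev⁻ {i} j∈ with toℕ i | toℕ<n i
  ∈prev⁻ (here refl) | suc k | k+1<m = cong suc (toℕ-fromℕ< (ℕ.<⇒≤ k+1<m))

  length-next : ∀ i → length (next i) ≤ 1
  length-next i with suc (toℕ i) <? m
  ... | yes _ = s≤s z≤n
  ... | no _  = z≤n

  length-prev : ∀ i → length (prev i) ≤ 1
  length-prev i with toℕ i | toℕ<n i
  ... | zero  | _ = z≤n
  ... | suc k | _ = s≤s z≤n

  -- Roots must not be isolated: a tree with a single vertex would have a leaf lying in no other tree.
  nbrs : Fin m → List (Fin m)
  nbrs i = next i ++ prev i ++ kept i

  length-nbrs : ∀ i → length (nbrs i) ≤ 2 + D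
  length-nbrs i = ℕ.≤-trans (ℕ.≤-reflexive (trans (length-++ (next i)) (cong (length (next i) +_) (length-++ (prev i)))))
    (ℕ.+-mono-≤ (length-next i) (ℕ.+-mono-≤ (length-prev i) (length-kept i)))

  nbrs-sym : ∀ {i j} → j ∈ˡ nbrs i → i ∈ˡ nbrs j
  nbrs-sym {i} {j} j∈ with ∈-++⁻ (next i) j∈
  ... | inj₁ j∈next = ∈-++⁺ʳ (next j) (∈-++⁺ˡ (∈prev⁺ (∈next⁻ j∈next)))
  ... | inj₂ j∈′ with ∈-++⁻ (prev i) j∈′
  ...   | inj₁ j∈prev = ∈-++⁺ˡ (∈next⁺ (∈prev⁻ j∈prev))
  ...   | inj₂ j∈kept = ∈-++⁺ʳ (next j) (∈-++⁺ʳ (prev j) (kept-sym j∈kept))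

  nbrs-irrefl : ∀ {i} → i ∉ˡ nbrs i
  nbrs-irrefl {i} i∈ with ∈-++⁻ (next i) i∈
  ... | inj₁ i∈next = ℕ.1+n≢n (∈next⁻ i∈next)
  ... | inj₂ i∈′ with ∈-++⁻ (prev i) i∈′
  ...   | inj₁ i∈prev = ℕ.1+n≢n (∈prev⁻ i∈prev)
  ...   | inj₂ i∈kept = proj₁ (proj₂ (proj₂ (∈kept⁻ i∈kept))) refl

  consecutive : 2 ≤ m → ∀ i → ∃ λ j → suc (toℕ i) ≡ toℕ j ⊎ suc (toℕ j) ≡ toℕ i
  consecutive 2≤m i with suc (toℕ i) <? m
  ... | yes i+1<m = fromℕ< i+1<m , inj₁ (sym (toℕ-fromℕ< i+1<m))
  ... | no i+1≮m with toℕ i | toℕ<n i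
  ...   | zero  | _     = contradiction 2≤m i+1≮m
  ...   | suc k | k+1<m = fromℕ< (ℕ.<⇒≤ k+1<m) , inj₂ (cong suc (toℕ-fromℕ< (ℕ.<⇒≤ k+1<m)))

  nbrs-nonempty : 2 ≤ m → ∀ i → ∃ λ j → j ∈ˡ nbrs i
  nbrs-nonempty 2≤m i with consecutive 2≤m i
  ... | j , inj₁ eq = j , ∈-++⁺ˡ (∈next⁺ eq)
  ... | j , inj₂ eq = j , ∈-++⁺ʳ (next i) (∈-++⁺ˡ (∈prev⁺ eq))

  -- Without its heavy roots each set still has `k` elements, so an edge of `L` joins two light
  -- roots. They are distinct by disjointness, hence the edge survives the capping.
  joined : ∀ k → (∀ A B → k ≤ ∣ A ∣ → k ≤ ∣ B ∣ → Any (λ e → Joins e (A , B)) L) →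
           ∀ A B → Empty (A ∩ B) → k + ∣ heavy ∣ ≤ ∣ A ∣ → k + ∣ heavy ∣ ≤ ∣ B ∣ →
           ∃ λ x → ∃ λ y → x ∈ A × y ∈ B × y ∈ˡ nbrs x
  joined k hit A B disjoint k≤A k≤B =
    let (x , y) , e∈ , x∈A─ , y∈B─ = find (hit (A ─ heavy) (B ─ heavy) (light A k≤A) (light B k≤B))
        x∈A = p─q⊆p A heavy x∈A─
        y∈B = p─q⊆p B heavy y∈B─
    in x , y , x∈A , y∈B , ∈-++⁺ʳ (next x) (∈-++⁺ʳ (prev x) (∈kept⁺ (¬heavy A x∈A─) (¬heavy B y∈B─)
        (λ x≡y → disjoint (x , x∈p∩q⁺ (x∈A , subst (_∈ B) (sym x≡y) y∈B))) (∈-++⁺ˡ (∈out e∈))))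
    where
    light : ∀ A → k + ∣ heavy ∣ ≤ ∣ A ∣ → k ≤ ∣ A ─ heavy ∣
    light A k≤ = ℕ.+-cancelʳ-≤ ∣ heavy ∣ _ _ (ℕ.≤-trans k≤ (∣p∣≤∣p─q∣+∣q∣ A heavy))
    ¬heavy : ∀ A {x} → x ∈ A ─ heavy → ¬ (D ≤ degree x)
    ¬heavy A x∈ h = x∈p─q⇒x∉q A heavy x∈ (∈⟦⟧⁺ heavy? h)

-- Pseudomatchings by repeated removal.

module _ {n m : ℕ} (F : TreeFamily n m) (k : ℕ)
  (joined : ∀ U V → Empty (U ∩ V) → k ≤ ∣ U ∣ → k ≤ ∣ V ∣ → ∃ λ x → ∃ λ y → x ∈ U × y ∈ V × Adjacent F x y) where

  -- An adjacent pair exists while both sets have at least `k` elements. Each round removes one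
  -- element from either set, so a surplus of `s` allows `s` rounds.
  greedyMatching : ∀ s U V → Empty (U ∩ V) → k + s ≤ ∣ U ∣ → k + s ≤ ∣ V ∣ → Pseudomatching F U V s
  greedyMatching zero U V disjoint _ _ = record
    { a = λ () ; b = λ () ; a∈U = λ () ; b∈V = λ () ; adj = λ ()
    ; a-inj = λ {} ; b-inj = λ {} ; ab-disj = λ () }
  greedyMatching (suc s) U V disjoint U-big V-big
    with x , y , x∈U , y∈V , x~y ← joined U V disjoint (ℕ.m+n≤o⇒m≤o k U-big) (ℕ.m+n≤o⇒m≤o k V-big) = record
    { a = a′ ; b = b′ ; a∈U = a′∈U ; b∈V = b′∈V
    ; adj = λ { Fin.zero → x~y ; (Fin.suc l) → adj l }
    ; a-inj = a′-inj
    ; b-inj = b′-inj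
    ; ab-disj = λ l l′ eq → disjoint (_ , x∈p∩q⁺ (a′∈U l , subst (_∈ V) (sym eq) (b′∈V l′)))
    }
    where
    smaller : ∀ W z → k + suc s ≤ ∣ W ∣ → k + s ≤ ∣ W - z ∣
    smaller W z le = ℕ.≤-pred (ℕ.≤-trans (ℕ.≤-reflexive (sym (ℕ.+-suc k s))) (ℕ.≤-trans le (∣p∣≤1+∣p-x∣ W z)))
    rest : Pseudomatching F (U - x) (V - y) s
    rest = greedyMatching s (U - x) (V - y)
      (λ (z , z∈) → let z∈U , z∈V = x∈p∩q⁻ (U - x) (V - y) z∈ in
        disjoint (z , x∈p∩q⁺ (p─q⊆p U ⁅ x ⁆ z∈U , p─q⊆p V ⁅ y ⁆ z∈V)))
      (smaller U x U-big) (smaller V y V-big)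
    open Pseudomatching rest
    a′ b′ : Fin (suc s) → Fin m
    a′ Fin.zero    = x
    a′ (Fin.suc l) = a l
    b′ Fin.zero    = y
    b′ (Fin.suc l) = b l
    a′∈U : ∀ l → a′ l ∈ U
    a′∈U Fin.zero    = x∈U
    a′∈U (Fin.suc l) = p─q⊆p U ⁅ x ⁆ (a∈U l)
    b′∈V : ∀ l → b′ l ∈ V
    b′∈V Fin.zero    = y∈V
    b′∈V (Fin.suc l) = p─q⊆p V ⁅ y ⁆ (b∈V l)
    a′-inj : Injective _≡_ _≡_ a′
    a′-inj {Fin.zero}  {Fin.zero}  _  = refl
    a′-inj {Fin.zero}  {Fin.suc l} eq = contradiction (subst (_∈ U - x) (sym eq) (a∈U l)) (x∉p-x U x)
    a′-inj {Fin.suc l} {Fin.zero}  eq = contradiction (subst (_∈ U - x) eq (a∈U l)) (x∉p-x U x)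
    a′-inj {Fin.suc l} {Fin.suc _} eq = cong Fin.suc (a-inj eq)
    b′-inj : Injective _≡_ _≡_ b′
    b′-inj {Fin.zero}  {Fin.zero}  _  = refl
    b′-inj {Fin.zero}  {Fin.suc l} eq = contradiction (subst (_∈ V - y) (sym eq) (b∈V l)) (x∉p-x V y)
    b′-inj {Fin.suc l} {Fin.zero}  eq = contradiction (subst (_∈ V - y) eq (b∈V l)) (x∉p-x V y)
    b′-inj {Fin.suc l} {Fin.suc _} eq = cong Fin.suc (b-inj eq)

-- Integer roots and numerical estimates.

*-^-distrib : ∀ a b e → (a * b) ^ e ≡ a ^ e * b ^ e
*-^-distrib a b zero    = refl
*-^-distrib a b (suc e) = trans (cong (a * b *_) (*-^-distrib a b e)) (interchange a b (a ^ e) (b ^ e))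
  where
  interchange : ∀ a b c d → a * b * (c * d) ≡ a * c * (b * d)
  interchange = solve-∀

integerRoot : ∀ e .{{_ : NonZero e}} m → ∃ λ r → r ^ e ≤ m × m < suc r ^ e
integerRoot e@(suc _) zero = 0 , z≤n , ℕ.m^n>0 1 e
integerRoot e (suc m) with r , r^e≤m , m<[1+r]^e ← integerRoot e m with suc m <? suc r ^ e
... | yes lt = r , ℕ.m≤n⇒m≤1+n r^e≤m , lt
... | no ≮   = suc r , ℕ.≮⇒≥ ≮ , ℕ.≤-<-trans m<[1+r]^e (ℕ.^-monoˡ-< e (ℕ.n<1+n (suc r)))

^-reflects-< : ∀ e {a b} → a ^ e < b ^ e → a < b
^-reflects-< e {a} {b} lt = ℕ.≰⇒> λ b≤a → ℕ.<⇒≱ lt (ℕ.^-monoˡ-≤ e b≤a)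

integerRoot-≥ : ∀ b e .{{_ : NonZero e}} m → b ^ e ≤ m → ∃ λ r → b ≤ r × r ^ e ≤ m × m < suc r ^ e
integerRoot-≥ b e m b^e≤m with r , r^e≤m , m<[1+r]^e ← integerRoot e m =
  r , ℕ.≤-pred (^-reflects-< e (ℕ.≤-<-trans b^e≤m m<[1+r]^e)) , r^e≤m , m<[1+r]^e

-- r ≤ m^(1/(e+1)) and m ≤ r w give m^(e/(e+1)) ≤ w; root-≥ is a converse for q > m^(1/(e+1)). Stating e′ ≡ suc e
-- separately keeps the conversion checker from unfolding powers when e′ is the literal 1000.
root-≤ : ∀ e {e′} → e′ ≡ suc e → ∀ {m r w} .{{_ : NonZero m}} → r ^ e′ ≤ m → m ≤ r * w → m ^ e ≤ w ^ e′
root-≤ e refl {m} {r} {w} r^e≤m m≤rw = ℕ.*-cancelˡ-≤ m (begin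
  m ^ suc e             ≤⟨ ℕ.^-monoˡ-≤ (suc e) m≤rw ⟩
  (r * w) ^ suc e       ≡⟨ *-^-distrib r w (suc e) ⟩
  r ^ suc e * w ^ suc e ≤⟨ ℕ.*-monoˡ-≤ (w ^ suc e) r^e≤m ⟩
  m * w ^ suc e         ∎)
  where open ≤-Reasoning

root-≥ : ∀ e {e′} → e′ ≡ suc e → ∀ {m q u} → m < q ^ e′ → m ^ e ≤ u ^ e′ → m ≤ q * u
root-≥ e refl {m} {q} {u} m<q^e m^e≤u = ℕ.≮⇒≥ λ qu<m → ℕ.<⇒≱ (ℕ.^-monoˡ-< (suc e) qu<m) (begin
  m * m ^ e             ≤⟨ ℕ.*-mono-≤ (ℕ.<⇒≤ m<q^e) m^e≤u ⟩
  q ^ suc e * u ^ suc e ≡⟨ *-^-distrib q u (suc e) ⟨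
  (q * u) ^ suc e       ∎)
  where open ≤-Reasoning

-- This is w ≤ m^(a/b) ≤ m^(d/c) without fractional exponents, passing through powers of `r`.
^-bound : ∀ a b c d {r w m} .{{_ : NonZero r}} → a * c ≤ b * d → w ≤ r ^ a → r ^ b ≤ m → w ^ c ≤ m ^ d
^-bound a b c d {r} {w} {m} ac≤bd w≤ ≤m = begin
  w ^ c       ≤⟨ ℕ.^-monoˡ-≤ c w≤ ⟩
  (r ^ a) ^ c ≡⟨ ℕ.^-*-assoc r a c ⟩
  r ^ (a * c) ≤⟨ ℕ.^-monoʳ-≤ r ac≤bd ⟩
  r ^ (b * d) ≡⟨ ℕ.^-*-assoc r b d ⟨
  (r ^ b) ^ d ≤⟨ ℕ.^-monoˡ-≤ d ≤m ⟩
  m ^ d       ∎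
  where open ≤-Reasoning

r*r≤r^[2+e] : ∀ r .{{_ : NonZero r}} e → r * r ≤ r ^ suc (suc e)
r*r≤r^[2+e] r e = ℕ.*-monoʳ-≤ r (ℕ.m≤m*n r (r ^ e) {{ℕ.m^n≢0 r e}})

quotient : ∀ m d → 1 ≤ d → ∃ λ t → d * t ≤ m × m ≤ d * suc t
quotient m d@(suc _) _ = m / d ,
  ℕ.≤-trans (ℕ.≤-reflexive (ℕ.*-comm d (m / d))) (m/n*n≤m m d) ,
  (begin
    m                       ≡⟨ m≡m%n+[m/n]*n m d ⟩
    m % d + m / d * d       ≤⟨ ℕ.+-monoˡ-≤ (m / d * d) (ℕ.<⇒≤ (m%n<n m d)) ⟩
    suc (m / d) * d         ≡⟨ ℕ.*-comm (suc (m / d)) d ⟩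
    d * suc (m / d)         ∎)
  where open ≤-Reasoning

-- The degree sum is at most 18r²(2m + 1) ≤ 54r²m. The cap 648r³ = 54r² · 12r is chosen so that at
-- most m/(12r) roots reach it.
few-heavy : ∀ {m r h} .{{_ : NonZero r}} → 1 ≤ m →
            h * (648 * (r * r * r)) ≤ 9 * (r * r) * suc (m + m) + 9 * (r * r) * suc (m + m) →
            12 * r * h ≤ m
few-heavy {m} {r} {h} 1≤m bound = ℕ.*-cancelˡ-≤ (54 * (r * r)) {{ℕ.m*n≢0 54 (r * r) {{_}} {{ℕ.m*n≢0 r r}}}} (begin
  54 * (r * r) * (12 * r * h)                                     ≡⟨ regroup r h ⟩
  h * (648 * (r * r * r))                                         ≤⟨ bound ⟩
  9 * (r * r) * suc (m + m) + 9 * (r * r) * suc (m + m)           ≡⟨ double (r * r) (suc (m + m)) ⟩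
  18 * (r * r) * suc (m + m)                                      ≤⟨ ℕ.*-monoʳ-≤ (18 * (r * r)) (ℕ.+-monoˡ-≤ (m + m) 1≤m) ⟩
  18 * (r * r) * (m + (m + m))                                    ≡⟨ triple (r * r) m ⟩
  54 * (r * r) * m                                                ∎)
  where
  open ≤-Reasoning
  regroup : ∀ r h → 54 * (r * r) * (12 * r * h) ≡ h * (648 * (r * r * r))
  regroup = solve-∀
  double : ∀ a b → 9 * a * b + 9 * a * b ≡ 18 * a * b
  double = solve-∀
  triple : ∀ a m → 18 * a * (m + (m + m)) ≡ 54 * a * m
  triple = solve-∀

-- In units of m/(12r), the terms 2t, h and 2 are at most 8, 1 and 1. Their total 10m/(12r) is at
-- most m/(r+1) once r ≥ 5, and `u` is at least that large.
room : ∀ {m r t h u} .{{_ : NonZero r}} → 5 ≤ r → 24 * r ≤ m → 3 * r * t ≤ m → 12 * r * h ≤ m → m ≤ suc r * u →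
       suc t + h + suc t ≤ u
room {m} {r} {t} {h} {u} 5≤r 24r≤m 3rt≤m 12rh≤m m≤ = ℕ.*-cancelˡ-≤ (12 * r * suc r) {{ℕ.m*n≢0 (12 * r) (suc r) {{ℕ.m*n≢0 12 r}}}} (begin
  12 * r * suc r * (suc t + h + suc t)                    ≡⟨ regroup r t h ⟩
  suc r * (8 * (3 * r * t) + 12 * r * h + 24 * r)         ≤⟨ ℕ.*-monoʳ-≤ (suc r) (ℕ.+-mono-≤ (ℕ.+-mono-≤ (ℕ.*-monoʳ-≤ 8 3rt≤m) 12rh≤m) 24r≤m) ⟩
  suc r * (8 * m + m + m)                                 ≡⟨ split r m ⟩
  10 * r * m + 2 * 5 * m                                  ≤⟨ ℕ.+-monoʳ-≤ (10 * r * m) (ℕ.*-monoˡ-≤ m (ℕ.*-monoʳ-≤ 2 5≤r)) ⟩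
  10 * r * m + 2 * r * m                                  ≡⟨ merge r m ⟩
  12 * r * m                                              ≤⟨ ℕ.*-monoʳ-≤ (12 * r) m≤ ⟩
  12 * r * (suc r * u)                                    ≡⟨ ℕ.*-assoc (12 * r) (suc r) u ⟨
  12 * r * suc r * u                                      ∎)
  where
  open ≤-Reasoning
  regroup : ∀ r t h → 12 * r * suc r * (suc t + h + suc t) ≡ suc r * (8 * (3 * r * t) + 12 * r * h + 24 * r)
  regroup = solve-∀
  split : ∀ r m → suc r * (8 * m + m + m) ≡ 10 * r * m + 2 * 5 * m
  split = solve-∀
  merge : ∀ r m → 10 * r * m + 2 * r * m ≡ 12 * r * m
  merge = solve-∀

-- The left side is the degree cap plus the two path neighbours; 650 = 648 + 2 absorbs both.
2+648r³≤r⁴ : ∀ r .{{_ : NonZero r}} → 650 ≤ r → 2 + 648 * (r * r * r) ≤ r ^ 4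
2+648r³≤r⁴ r 650≤r = begin
  2 * 1 + 648 * (r * r * r)           ≤⟨ ℕ.+-monoˡ-≤ _ (ℕ.*-monoʳ-≤ 2 (>-nonZero⁻¹ (r * r * r) {{ℕ.m*n≢0 (r * r) r {{ℕ.m*n≢0 r r}}}})) ⟩
  2 * (r * r * r) + 648 * (r * r * r) ≡⟨ merge (r * r * r) ⟩
  650 * (r * r * r)                   ≤⟨ ℕ.*-monoˡ-≤ (r * r * r) 650≤r ⟩
  r * (r * r * r)                     ≡⟨ power r ⟩
  r ^ 4                               ∎
  where
  open ≤-Reasoning
  merge : ∀ a → 2 * a + 648 * a ≡ 650 * a
  merge = solve-∀
  power : ∀ r → r * (r * r * r) ≡ r * (r * (r * (r * 1)))
  power = solve-∀

-- Assembling the pseudoexpander.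

construction : ∀ {m r t} → 650 ≤ r → r ^ 1000 ≤ m → m < suc r ^ 1000 → 3 * r * t ≤ m → m ≤ 3 * r * suc t →
  ∃ λ n → Σ (TreeFamily n m) λ F → IsBinaryTreeBased F × IsPseudoexpander F × PseudodegreeBound F
construction {m} {r} {t} 650≤r r^1000≤m m<[1+r]^1000 3rt≤m m≤3r[1+t] =
  n , family , binaryTreeBased , pseudoexpander , pseudodegree
  where
  open ≤-Reasoning
  instance
    r≢0 : NonZero r
    r≢0 = >-nonZero (ℕ.≤-trans (s≤s z≤n) 650≤r)

  24r≤m : 24 * r ≤ m
  24r≤m = begin
    24 * r   ≤⟨ ℕ.*-monoˡ-≤ r (ℕ.≤-trans (ℕ.≤ᵇ⇒≤ 24 650 tt) 650≤r) ⟩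
    r * r    ≤⟨ r*r≤r^[2+e] r 998 ⟩
    r ^ 1000 ≤⟨ r^1000≤m ⟩
    m        ∎

  2≤m : 2 ≤ m
  2≤m = ℕ.≤-trans (ℕ.*-mono-≤ {2} {24} {1} {r} (s≤s (s≤s z≤n)) (>-nonZero⁻¹ r)) 24r≤m

  instance
    m≢0 : NonZero m
    m≢0 = >-nonZero (ℕ.<⇒≤ 2≤m)

  -- Density 1/(9r²) in the form 1/`suc ρ`: sets of size t + 1 ≥ m/(3r) have products of at least
  -- this density.
  ρ = pred (9 * (r * r))

  suc-ρ : suc ρ ≡ 9 * (r * r)
  suc-ρ = ℕ.suc-pred (9 * (r * r)) {{ℕ.m*n≢0 9 (r * r) {{_}} {{ℕ.m*n≢0 r r}}}}

  m*m≤ : m * m ≤ suc ρ * (suc t * suc t)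
  m*m≤ = begin
    m * m                             ≤⟨ ℕ.*-mono-≤ m≤3r[1+t] m≤3r[1+t] ⟩
    3 * r * suc t * (3 * r * suc t)   ≡⟨ square r (suc t) ⟩
    9 * (r * r) * (suc t * suc t)     ≡⟨ cong (_* (suc t * suc t)) suc-ρ ⟨
    suc ρ * (suc t * suc t)           ∎
    where
    square : ∀ r s → 3 * r * s * (3 * r * s) ≡ 9 * (r * r) * (s * s)
    square = solve-∀

  edges = joiningEdges (ℕ.<⇒≤ 2≤m) ρ (suc t) m*m≤
  L     = proj₁ edges

  length-L : length L ≡ 9 * (r * r) * suc (m + m)
  length-L = trans (proj₁ (proj₂ edges)) (cong (_* suc (m + m)) suc-ρ)

  open CappedGraph L (648 * (r * r * r))
  open SubdividedStars nbrs nbrs-irrefl nbrs-sym (nbrs-nonempty 2≤m)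

  12rh≤m : 12 * r * ∣ heavy ∣ ≤ m
  12rh≤m = few-heavy (ℕ.<⇒≤ 2≤m) (ℕ.≤-trans ∣heavy∣*D≤ (ℕ.≤-reflexive (cong₂ _+_ length-L length-L)))

  pseudoexpander : IsPseudoexpander family
  pseudoexpander = record
    -- Trees of height at most 3 make the exponent 0.
    { height = λ i v _ → subst (λ k → 2 ^ (49 * k) ≤ m ^ 10) (sym (ℕ.m≤n⇒m∸n≡0 (s≤s (level≤2 (name v))))) (ℕ.m^n>0 m 10)
    ; expand = λ U V disjoint U-big V-big →
        suc t ,
        -- The size t + 1 is at least m/(3r), and r ≤ m^(1/1000) turns this into m^0.999/3.
        root-≤ 999 {1000} refl {m} {r} {3 * suc t} r^1000≤m (ℕ.≤-trans m≤3r[1+t] (ℕ.≤-reflexive (regroup r (suc t)))) ,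
        -- `joined` needs `suc t` light roots beside the heavy ones; a further `suc t` elements are
        -- used up by the matching.
        greedyMatching family (suc t + ∣ heavy ∣)
          (λ A B A∩B A-big B-big →
            let x , y , x∈A , y∈B , y∈ = joined (suc t) (proj₂ (proj₂ edges)) A B A∩B A-big B-big
            in x , y , x∈A , y∈B , adjacent⁺ y∈)
          (suc t) U V disjoint (enough U-big) (enough V-big)
    }
    where
    regroup : ∀ r s → 3 * r * s ≡ r * (3 * s)
    regroup = solve-∀
    enough : ∀ {u} → m ^ 999 ≤ u ^ 1000 → suc t + ∣ heavy ∣ + suc t ≤ u
    enough u-big = room {m} {r} (ℕ.≤-trans (ℕ.≤ᵇ⇒≤ 5 650 tt) 650≤r) 24r≤m 3rt≤m 12rh≤m (root-≥ 999 {1000} refl {m} {suc r} m<[1+r]^1000 u-big)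

  pseudodegree : PseudodegreeBound family
  -- Degrees are at most r⁴ ≤ m^(4/1000), and 4/1000 ≤ 10/49 because 4 · 49 ≤ 1000 · 10.
  pseudodegree i N N-adj = ^-bound 4 1000 49 10 (ℕ.≤ᵇ⇒≤ 196 10000 tt)
    (ℕ.≤-trans (∣p∣≤length N (nbrs i) (λ j∈ → adjacent⁻ (N-adj _ j∈))) (ℕ.≤-trans (length-nbrs i) (2+648r³≤r⁴ r 650≤r)))
    r^1000≤m

theorem1 : ∃ λ (M : ℕ) → ∀ (m : ℕ) → M ≤ m →
    ∃ λ (n : ℕ) → Σ (TreeFamily n m) λ F →
    IsBinaryTreeBased F × IsPseudoexpander F × PseudodegreeBound F
-- This threshold makes the integer part `r` of m^(1/1000) at least 650, as the degree estimate
-- demands; `t` is the integer part of m/(3r).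
theorem1 = 650 ^ 1000 , λ m M≤m →
  let r , 650≤r , r^1000≤m , m<[1+r]^1000 = integerRoot-≥ 650 1000 m M≤m
      t , 3rt≤m , m≤3r[1+t] = quotient m (3 * r) (ℕ.*-mono-≤ {1} {3} {1} {r} (s≤s z≤n) (ℕ.≤-trans (s≤s z≤n) 650≤r))
  in construction {m} {r} {t} 650≤r r^1000≤m m<[1+r]^1000 3rt≤m m≤3r[1+t]
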